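{- Let $b \in \mathbb{Z}$ with $1 \le b \le 9$ and $b \neq 7$. Then for every $k \in \mathbb{Z}$ there exists a rational pseudointegral triangle $T\subset\mathbb{R}^2$ with denominator greater than $k$ that has exactly one lattice point in its interior and exactly $b$ lattice points on its boundary.
   Context: A polytope $P \subset \mathbb{R}^d$ is rational if its vertices lie in $\mathbb{Q}^d$; its denominator is the least positive integer $k$ such that $kP$ has all vertices in $\mathbb{Z}^d$. $P$ is pseudointegral if its Ehrhart function $t \mapsto |tP \cap \mathbb{Z}^d|$ ($t\in\mathbb{Z}_{>0}$) is a polynomial function of $t$. Lattice points are points of $\mathbb{Z}^2$. -}

module Defs where

open import Data.Nat as ℕ using (ℕ)
open import Data.Integer as ℤ using (ℤ)
open import Data.Rational using (ℚ; _+_; _*_; _-_; _≤_; _<_; 0ℚ; 1ℚ; _/_)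
open import Data.Product using (Σ; _×_; _,_; ∃)
open import Data.List using (List; []; _∷_)
open import Data.List.Membership.Propositional using (_∈_)
open import Data.List.Relation.Unary.Unique.Propositional using (Unique)
open import Relation.Binary.PropositionalEquality using (_≡_; _≢_)
open import Relation.Nullary using (¬_)
open import Function.Bundles using (_⇔_)

Pt : Set
Pt = ℚ × ℚ

LPt : Set
LPt = ℤ × ℤ

ι : ℤ → ℚ
ι z = z / 1

ιP : LPt → Pt
ιP (x , y) = ι x , ι y

ιℕ : ℕ → ℚ
ιℕ n = ℤ.+ n / 1

record Triangle : Set where
  constructor tri
  field
    v₁ v₂ v₃ : Pt

open Triangle public

_·_ : ℚ → Pt → Pt
s · (x , y) = s * x , s * y

dilate : ℚ → Triangle → Triangle
dilate s (tri a b c) = tri (s · a) (s · b) (s · c)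

det : Triangle → ℚ
det (tri (a₁ , a₂) (b₁ , b₂) (c₁ , c₂)) =
  ((b₁ - a₁) * (c₂ - a₂)) - ((b₂ - a₂) * (c₁ - a₁))

NonDegenerate : Triangle → Set
NonDegenerate T = det T ≢ 0ℚ

IsComb : Triangle → ℚ → ℚ → ℚ → Pt → Set
IsComb (tri (a₁ , a₂) (b₁ , b₂) (c₁ , c₂)) l₁ l₂ l₃ (p₁ , p₂) =
  (l₁ + l₂ + l₃ ≡ 1ℚ) ×
  (p₁ ≡ l₁ * a₁ + l₂ * b₁ + l₃ * c₁) ×
  (p₂ ≡ l₁ * a₂ + l₂ * b₂ + l₃ * c₂)

-- p lies in the (closed) triangle = convex hull of the vertices
-- (for rational p and a non-degenerate rational triangle, barycentric coordinates are rational)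
InTri : Triangle → Pt → Set
InTri T p = Σ ℚ λ l₁ → Σ ℚ λ l₂ → Σ ℚ λ l₃ →
  (0ℚ ≤ l₁) × (0ℚ ≤ l₂) × (0ℚ ≤ l₃) × IsComb T l₁ l₂ l₃ p

InInterior : Triangle → Pt → Set
InInterior T p = Σ ℚ λ l₁ → Σ ℚ λ l₂ → Σ ℚ λ l₃ →
  (0ℚ < l₁) × (0ℚ < l₂) × (0ℚ < l₃) × IsComb T l₁ l₂ l₃ p

OnBoundary : Triangle → Pt → Set
OnBoundary T p = InTri T p × ¬ InInterior T p

HasCard : (LPt → Set) → ℕ → Set
HasCard P n = Σ (List LPt) λ xs →
  Unique xs × (Data.List.length xs ≡ n) × (∀ p → (p ∈ xs) ⇔ P p)
  where import Data.List

LatticeCount : Triangle → ℕ → Set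
LatticeCount T n = HasCard (λ p → InTri T (ιP p)) n

evalPoly : List ℚ → ℚ → ℚ
evalPoly [] x = 0ℚ
evalPoly (c ∷ cs) x = c + x * evalPoly cs x

Pseudointegral : Triangle → Set
Pseudointegral T = Σ (List ℚ) λ cs →
  ∀ (t : ℕ) → 1 ℕ.≤ t →
    Σ ℕ λ n → LatticeCount (dilate (ιℕ t) T) n × (ιℕ n ≡ evalPoly cs (ιℕ t))

IntegralPt : Pt → Set
IntegralPt (x , y) = (∃ λ (m : ℤ) → x ≡ ι m) × (∃ λ (m : ℤ) → y ≡ ι m)

IntegralTri : Triangle → Set
IntegralTri (tri a b c) = IntegralPt a × IntegralPt b × IntegralPt c

IsDenominator : Triangle → ℕ → Set
IsDenominator T d = (1 ℕ.≤ d) × IntegralTri (dilate (ιℕ d) T) ×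
  (∀ d' → 1 ℕ.≤ d' → IntegralTri (dilate (ιℕ d') T) → d ℕ.≤ d')

{-# OPTIONS --safe #-}

-- Let N = 1 + a + p with N² = D r a p, and let T be the triangle
-- x ≥ -1, x + r y ≥ -1, (N - 1) x + r p y ≤ 1, with vertices (-1 , 0), (-1 , N / (r p)) and
-- (N / a - 1 , - N / (r a)). The edges of m T carry integral affine coordinates that fit together
-- at the vertices, and going around the boundary once increases the coordinate by D m. Hence the
-- boundary of m T contains exactly D m lattice points for every m ≥ 1. Since every nonzero lattice
-- point lies on the boundary of exactly one m T, the Ehrhart function of T is
-- 1 + D (1 + ... + t), the origin is the only interior lattice point of T, and D lattice points
-- lie on the boundary. For D r = 5, 6, 8, 9 the equation has infinitely many solutions by Vieta
-- jumping, and the denominator of T grows with p because a and p are coprime.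
module Submission where

open import Defs
open import Data.Empty using (⊥; ⊥-elim)
open import Data.Fin using (Fin; toℕ; fromℕ<)
open import Data.Fin.Properties using (toℕ-injective; toℕ-fromℕ<; toℕ<n)
open import Data.Integer as ℤ using (ℤ; +_; -[1+_]; 0ℤ; 1ℤ; +≤+; +<+; -<+)
open import Data.Integer.Divisibility.Signed using (divides; ∣⇒∣ᵤ)
import Data.Integer.Properties as ℤ
import Data.Integer.Tactic.RingSolver as ℤ-Solver
open import Data.List using ([]; _∷_; _++_; tabulate)
open import Data.List.Membership.Propositional using (_∈_)
open import Data.List.Membership.Propositional.Properties
  using (∈-++⁺ˡ; ∈-++⁺ʳ; ∈-++⁻; ∈-tabulate⁺; ∈-tabulate⁻)
open import Data.List.Properties using (length-++; length-tabulate)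
import Data.List.Relation.Unary.All as All
import Data.List.Relation.Unary.AllPairs as AllPairs
open import Data.List.Relation.Unary.Any using (here)
open import Data.List.Relation.Unary.Unique.Propositional.Properties using (++⁺; tabulate⁺)
open import Data.Nat as ℕ using (ℕ; zero; suc; s≤s; z≤n)
import Data.Nat.Coprimality as Coprimality
import Data.Nat.Divisibility as ℕ
open import Data.Nat.Induction using (<-rec)
import Data.Nat.Properties as ℕ
import Data.Nat.Tactic.RingSolver as ℕ-Solver
open import Data.Product using (Σ; ∃; _×_; _,_; proj₁; proj₂)
open import Data.Sum using (_⊎_; inj₁; inj₂; [_,_]′; map)
open import Function using (_∘_; mk⇔; Equivalence; _⇔_)
open import Level using (0ℓ)
open import Relation.Binary.PropositionalEquality
open import Relation.Nullary using (¬_; Dec; yes; no; _×-dec_)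
open import Relation.Nullary.Decidable using (dec⇒maybe; map′)
open import Tactic.RingSolver using (solve-∀)
open import Tactic.RingSolver.Core.AlmostCommutativeRing
  using (AlmostCommutativeRing; fromCommutativeRing)

-- Sign arithmetic of the integers.

module LatticeGeometry where

  open import Data.Integer hiding (suc)
  open import Data.Integer.Properties

  nonneg-* : ∀ {x y} → 0ℤ ≤ x → 0ℤ ≤ y → 0ℤ ≤ x * y
  nonneg-* {x} {y} 0≤x 0≤y =
    subst (_≤ x * y) (*-zeroʳ x) (*-monoˡ-≤-nonNeg x {{nonNegative 0≤x}} 0≤y)

  pos-*⁺ : ∀ {x y} → 0ℤ < x → 0ℤ < y → 0ℤ < x * y
  pos-*⁺ {x} {y} 0<x 0<y =
    subst (_< x * y) (*-zeroʳ x) (*-monoˡ-<-pos x {{positive 0<x}} 0<y)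

  nonneg-*⁻ : ∀ {x y} → 0ℤ < x → 0ℤ ≤ x * y → 0ℤ ≤ y
  nonneg-*⁻ {x} {y} 0<x 0≤xy =
    *-cancelˡ-≤-pos 0ℤ y x {{positive 0<x}} (subst (_≤ x * y) (sym (*-zeroʳ x)) 0≤xy)

  pos-*⁻ : ∀ {x y} → 0ℤ < x → 0ℤ < x * y → 0ℤ < y
  pos-*⁻ {x} {y} 0<x 0<xy =
    *-cancelˡ-<-nonNeg x {{nonNegative (<⇒≤ 0<x)}} (subst (_< x * y) (sym (*-zeroʳ x)) 0<xy)

  i<j⇒0<j-i : ∀ {i j} → i < j → 0ℤ < j - i
  i<j⇒0<j-i {i} {j} i<j = subst (_< j - i) (+-inverseʳ i) (+-monoˡ-< (- i) i<j)

  0<j-i⇒i<j : ∀ {i j} → 0ℤ < j - i → i < j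
  0<j-i⇒i<j {i} {j} 0<j-i =
    subst₂ _<_ (+-identityˡ i) (identity i j) (+-monoˡ-< i 0<j-i)
    where
    identity : ∀ i j → j - i + i ≡ j
    identity = ℤ-Solver.solve-∀

  0<suc⇒0≤ : ∀ {i} → 0ℤ < 1ℤ + i → 0ℤ ≤ i
  0<suc⇒0≤ {+ n} _ = +≤+ z≤n
  0<suc⇒0≤ { -[1+ 0 ]} (+<+ ())
  0<suc⇒0≤ { -[1+ suc n ]} ()

  -- Reads an identity produced by the ring solver modulo the relation e ≡ 0.
  ≡-mod : ∀ {x y e} c → e ≡ 0ℤ → x ≡ y + c * e → x ≡ y
  ≡-mod {y = y} c refl eq = trans eq (trans (cong (_+_ y) (*-zeroʳ c)) (+-identityʳ y))

  -- Lattice points on the boundary of a dilate.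

  module Levels (D r a p : ℤ)
    (0<r : 0ℤ < r) (0<a : 0ℤ < a) (0<p : 0ℤ < p)
    (square : (1ℤ + a + p) * (1ℤ + a + p) - D * r * a * p ≡ 0ℤ) where

    N : ℤ
    N = 1ℤ + a + p

    -- Slacks of the inequalities (N - 1) x + r p y ≤ m, x ≥ -m and x + r y ≥ -m.
    h₁ h₂ h₃ : ℤ → LPt → ℤ
    h₁ m (x , y) = m - (a + p) * x - r * p * y
    h₂ m (x , y) = x + m
    h₃ m (x , y) = x + r * y + m

    Within : ℤ → LPt → Set
    Within m q = (0ℤ ≤ h₁ m q) × (0ℤ ≤ h₂ m q) × (0ℤ ≤ h₃ m q)

    -- The three edges of the m-th dilate, traversed from the vertex (-m , 0), each with an integral
    -- affine coordinate s. The coordinates of consecutive edges agree where the edges meet, although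
    -- that vertex need not be a lattice point; a lattice vertex is assigned to one edge only.
    data Edge (m s : ℤ) (q : LPt) : Set where
      edge₂ : h₂ m q ≡ 0ℤ → s ≡ proj₂ q → Edge m s q
      edge₁ : 0ℤ < h₂ m q → h₁ m q ≡ 0ℤ →
              s ≡ D * a * proj₁ q + (1ℤ + N) * proj₂ q → Edge m s q
      edge₃ : 0ℤ < h₂ m q → 0ℤ < h₁ m q → h₃ m q ≡ 0ℤ →
              s ≡ D * m + proj₂ q → Edge m s q

    h₁-suc : ∀ m q → h₁ (1ℤ + m) q ≡ 1ℤ + h₁ m q
    h₁-suc m (x , y) = identity a p r m x y
      where
      identity : ∀ a p r m x y →
        1ℤ + m - (a + p) * x - r * p * y ≡ 1ℤ + (m - (a + p) * x - r * p * y)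
      identity = ℤ-Solver.solve-∀

    h₂-suc : ∀ m q → h₂ (1ℤ + m) q ≡ 1ℤ + h₂ m q
    h₂-suc m (x , y) = identity m x
      where
      identity : ∀ m x → x + (1ℤ + m) ≡ 1ℤ + (x + m)
      identity = ℤ-Solver.solve-∀

    h₃-suc : ∀ m q → h₃ (1ℤ + m) q ≡ 1ℤ + h₃ m q
    h₃-suc m (x , y) = identity r m x y
      where
      identity : ∀ r m x y → x + r * y + (1ℤ + m) ≡ 1ℤ + (x + r * y + m)
      identity = ℤ-Solver.solve-∀

    -- Up to the factor `N * m`, the three terms are the barycentric coordinates of q in the m-th
    -- dilate. At m = 0, nonnegative slacks are thereby forced to vanish.
    slack-sum : ∀ m q → h₁ m q + p * h₃ m q + a * h₂ m q ≡ N * m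
    slack-sum m (x , y) = identity a p r m x y
      where
      identity : ∀ a p r m x y →
        m - (a + p) * x - r * p * y + p * (x + r * y + m) + a * (x + m)
        ≡ (1ℤ + a + p) * m
      identity = ℤ-Solver.solve-∀

    -- The strict inequalities in the constructors give every point to at most one edge, which
    -- refutes the mixed cases.
    edge-injective : ∀ {m s s′ q} → Edge m s q → Edge m s′ q → s ≡ s′
    edge-injective (edge₂ _ e) (edge₂ _ e′) = trans e (sym e′)
    edge-injective (edge₂ z _) (edge₁ nz _ _) = ⊥-elim (<-irrefl (sym z) nz)
    edge-injective (edge₂ z _) (edge₃ nz _ _ _) = ⊥-elim (<-irrefl (sym z) nz)
    edge-injective (edge₁ nz _ _) (edge₂ z _) = ⊥-elim (<-irrefl (sym z) nz)
    edge-injective (edge₁ _ _ e) (edge₁ _ _ e′) = trans e (sym e′)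
    edge-injective (edge₁ _ z _) (edge₃ _ nz _ _) = ⊥-elim (<-irrefl (sym z) nz)
    edge-injective (edge₃ nz _ _ _) (edge₂ z _) = ⊥-elim (<-irrefl (sym z) nz)
    edge-injective (edge₃ _ nz _ _) (edge₁ _ z _) = ⊥-elim (<-irrefl (sym z) nz)
    edge-injective (edge₃ _ _ _ e) (edge₃ _ _ _ e′) = trans e (sym e′)

    -- The coordinate s lies beyond the end of edge₂ when u m s > 0, and beyond the end of edge₁ when
    -- v m s < 0.
    u v : ℤ → ℤ → ℤ
    u m s = r * p * s - N * m
    v m s = r * a * (D * m - s) - N * m

    0<N : 0ℤ < N
    0<N = +-mono-< (+-mono-< {0ℤ} {1ℤ} (+<+ (s≤s z≤n)) 0<a) 0<p

    -- On each edge, `u` and `v` are slacks of the other edges up to sign, a positive factor and a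
    -- positive term. This and the next four identities therefore fix their signs edge by edge, even
    -- where two edges meet outside the lattice.
    u-edge₂ : ∀ {m s} q → h₂ m q ≡ 0ℤ → s ≡ proj₂ q → u m s ≡ - h₁ m q
    u-edge₂ {m} (x , y) on refl = ≡-mod (- (a + p)) on (identity a p r m x y)
      where
      identity : ∀ a p r m x y →
        r * p * y - (1ℤ + a + p) * m
        ≡ - (m - (a + p) * x - r * p * y) + - (a + p) * (x + m)
      identity = ℤ-Solver.solve-∀

    u-edge₁ : ∀ {m s} q → h₁ m q ≡ 0ℤ → s ≡ D * a * proj₁ q + (1ℤ + N) * proj₂ q →
              u m s ≡ h₂ m q
    u-edge₁ {m} (x , y) on refl =
      ≡-mod (- (1ℤ + N)) on (≡-mod (- x) square (identity D a p r m x y))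
      where
      identity : ∀ D a p r m x y → let N = 1ℤ + a + p in
        r * p * (D * a * x + (1ℤ + N) * y) - N * m
        ≡ x + m + - (1ℤ + N) * (m - (a + p) * x - r * p * y)
          + - x * (N * N - D * r * a * p)
      identity = ℤ-Solver.solve-∀

    v-edge₁ : ∀ {m s} q → h₁ m q ≡ 0ℤ → s ≡ D * a * proj₁ q + (1ℤ + N) * proj₂ q →
              v m s ≡ h₃ m q
    v-edge₁ {m} (x , y) on refl =
      ≡-mod (r * D * a - (1ℤ + N)) on (≡-mod (- (x + r * y)) square (identity D a p r m x y))
      where
      identity : ∀ D a p r m x y → let N = 1ℤ + a + p in
        r * a * (D * m - (D * a * x + (1ℤ + N) * y)) - N * m
        ≡ x + r * y + m + (r * D * a - (1ℤ + N)) * (m - (a + p) * x - r * p * y)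
          + - (x + r * y) * (N * N - D * r * a * p)
      identity = ℤ-Solver.solve-∀

    -- The factor a produces the product `D * r * a * p`, which `square` replaces by N².
    u-edge₃ : ∀ {m s} q → h₃ m q ≡ 0ℤ → s ≡ D * m + proj₂ q →
              a * u m s ≡ N * m + p * h₁ m q
    u-edge₃ {m} (x , y) on refl =
      ≡-mod (p * (a + p)) on (≡-mod (- m) square (identity D a p r m x y))
      where
      identity : ∀ D a p r m x y → let N = 1ℤ + a + p in
        a * (r * p * (D * m + y) - N * m)
        ≡ N * m + p * (m - (a + p) * x - r * p * y)
          + p * (a + p) * (x + r * y + m) + - m * (N * N - D * r * a * p)
      identity = ℤ-Solver.solve-∀

    v-edge₃ : ∀ {m s} q → h₃ m q ≡ 0ℤ → s ≡ D * m + proj₂ q → v m s ≡ - h₁ m q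
    v-edge₃ {m} (x , y) on refl = ≡-mod (- (a + p)) on (identity D a p r m x y)
      where
      identity : ∀ D a p r m x y →
        r * a * (D * m - (D * m + y)) - (1ℤ + a + p) * m
        ≡ - (m - (a + p) * x - r * p * y) + - (a + p) * (x + r * y + m)
      identity = ℤ-Solver.solve-∀

    module _ {m : ℤ} (0<m : 0ℤ < m) where

      0<Nm : 0ℤ < N * m
      0<Nm = pos-*⁺ 0<N 0<m

      edge₃⇒0<u : ∀ {s} q → 0ℤ < h₁ m q → h₃ m q ≡ 0ℤ → s ≡ D * m + proj₂ q → 0ℤ < u m s
      edge₃⇒0<u q 0<h₁ on param = pos-*⁻ 0<a
        (subst (0ℤ <_) (sym (u-edge₃ q on param)) (+-mono-< 0<Nm (pos-*⁺ 0<p 0<h₁)))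

      edge₂-point : ∀ {s} q → h₂ m q ≡ 0ℤ → s ≡ proj₂ q → q ≡ (- m , s)
      edge₂-point (x , y) on refl = cong (_, y) (≡-mod 1ℤ on (identity m x))
        where
        identity : ∀ m x → x ≡ - m + 1ℤ * (x + m)
        identity = ℤ-Solver.solve-∀

      -- The equations for s and for `h₁` form a linear system in x and y with determinant D a r p -
      -- (1 + N)(a + p) = N² - (N + 1)(N - 1) = 1. It can thus be inverted over the integers.
      edge₁-point : ∀ {s} q → h₁ m q ≡ 0ℤ → s ≡ D * a * proj₁ q + (1ℤ + N) * proj₂ q →
                    q ≡ (r * p * s - (1ℤ + N) * m , D * a * m - (a + p) * s)
      edge₁-point (x , y) on refl = cong₂ _,_
        (≡-mod (1ℤ + N) on (≡-mod x square (identity₁ D a p r m x y)))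
        (≡-mod (- (D * a)) on (≡-mod y square (identity₂ D a p r m x y)))
        where
        identity₁ : ∀ D a p r m x y → let N = 1ℤ + a + p in
          x ≡ r * p * (D * a * x + (1ℤ + N) * y) - (1ℤ + N) * m
              + (1ℤ + N) * (m - (a + p) * x - r * p * y) + x * (N * N - D * r * a * p)
        identity₁ = ℤ-Solver.solve-∀
        identity₂ : ∀ D a p r m x y → let N = 1ℤ + a + p in
          y ≡ D * a * m - (a + p) * (D * a * x + (1ℤ + N) * y)
              + - (D * a) * (m - (a + p) * x - r * p * y) + y * (N * N - D * r * a * p)
        identity₂ = ℤ-Solver.solve-∀

      edge₃-point : ∀ {s} q → h₃ m q ≡ 0ℤ → s ≡ D * m + proj₂ q →
                    q ≡ (r * (D * m - s) - m , - (D * m - s))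
      edge₃-point (x , y) on refl = cong₂ _,_
        (≡-mod 1ℤ on (identity₁ D r m x y)) (identity₂ D m y)
        where
        identity₁ : ∀ D r m x y →
          x ≡ r * (D * m - (D * m + y)) - m + 1ℤ * (x + r * y + m)
        identity₁ = ℤ-Solver.solve-∀
        identity₂ : ∀ D m y → y ≡ - (D * m - (D * m + y))
        identity₂ = ℤ-Solver.solve-∀

      -- Signs separate the edges: `u` is at most 0 on `edge₂` and positive on the other two, and
      -- `v` is at least 0 on `edge₁` and negative on `edge₃`.
      edge₂≢edge₁ : ∀ {s} q q′ → Within m q → h₂ m q ≡ 0ℤ → s ≡ proj₂ q →
        0ℤ < h₂ m q′ → h₁ m q′ ≡ 0ℤ → s ≡ D * a * proj₁ q′ + (1ℤ + N) * proj₂ q′ → ⊥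
      edge₂≢edge₁ q q′ (0≤h₁ , _) on e 0<h₂ on′ e′ = <⇒≱
        (subst (0ℤ <_) (sym (u-edge₁ q′ on′ e′)) 0<h₂)
        (subst (_≤ 0ℤ) (sym (u-edge₂ q on e)) (neg-mono-≤ 0≤h₁))

      edge₂≢edge₃ : ∀ {s} q q′ → Within m q → h₂ m q ≡ 0ℤ → s ≡ proj₂ q →
        0ℤ < h₁ m q′ → h₃ m q′ ≡ 0ℤ → s ≡ D * m + proj₂ q′ → ⊥
      edge₂≢edge₃ q q′ (0≤h₁ , _) on e 0<h₁ on′ e′ = <⇒≱
        (edge₃⇒0<u q′ 0<h₁ on′ e′)
        (subst (_≤ 0ℤ) (sym (u-edge₂ q on e)) (neg-mono-≤ 0≤h₁))

      edge₁≢edge₃ : ∀ {s} q q′ → Within m q →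
        h₁ m q ≡ 0ℤ → s ≡ D * a * proj₁ q + (1ℤ + N) * proj₂ q →
        0ℤ < h₁ m q′ → h₃ m q′ ≡ 0ℤ → s ≡ D * m + proj₂ q′ → ⊥
      edge₁≢edge₃ q q′ (_ , _ , 0≤h₃) on e 0<h₁ on′ e′ = <⇒≱
        (subst (_< 0ℤ) (sym (v-edge₃ q′ on′ e′)) (neg-mono-< 0<h₁))
        (subst (0ℤ ≤_) (sym (v-edge₁ q on e)) 0≤h₃)

      edge-functional : ∀ {s} q q′ → Within m q → Within m q′ →
                        Edge m s q → Edge m s q′ → q ≡ q′
      edge-functional q q′ w w′ (edge₂ on e) (edge₂ on′ e′) =
        trans (edge₂-point q on e) (sym (edge₂-point q′ on′ e′))
      edge-functional q q′ w w′ (edge₁ _ on e) (edge₁ _ on′ e′) =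
        trans (edge₁-point q on e) (sym (edge₁-point q′ on′ e′))
      edge-functional q q′ w w′ (edge₃ _ _ on e) (edge₃ _ _ on′ e′) =
        trans (edge₃-point q on e) (sym (edge₃-point q′ on′ e′))
      edge-functional q q′ w w′ (edge₂ on e) (edge₁ 0<h₂ on′ e′) =
        ⊥-elim (edge₂≢edge₁ q q′ w on e 0<h₂ on′ e′)
      edge-functional q q′ w w′ (edge₁ 0<h₂ on e) (edge₂ on′ e′) =
        ⊥-elim (edge₂≢edge₁ q′ q w′ on′ e′ 0<h₂ on e)
      edge-functional q q′ w w′ (edge₂ on e) (edge₃ _ 0<h₁ on′ e′) =
        ⊥-elim (edge₂≢edge₃ q q′ w on e 0<h₁ on′ e′)
      edge-functional q q′ w w′ (edge₃ _ 0<h₁ on e) (edge₂ on′ e′) =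
        ⊥-elim (edge₂≢edge₃ q′ q w′ on′ e′ 0<h₁ on e)
      edge-functional q q′ w w′ (edge₁ _ on e) (edge₃ _ 0<h₁ on′ e′) =
        ⊥-elim (edge₁≢edge₃ q q′ w on e 0<h₁ on′ e′)
      edge-functional q q′ w w′ (edge₃ _ 0<h₁ on e) (edge₁ _ on′ e′) =
        ⊥-elim (edge₁≢edge₃ q′ q w′ on′ e′ 0<h₁ on e)

      -- The signs of `u` and `v` select the edge, and inverting its coordinate gives the point. The
      -- slacks off that edge are -u and r s on `edge₂`, u and v on `edge₁`, and -v and r (D m - s)
      -- on `edge₃`.
      edge-exists : ∀ {s} → 0ℤ ≤ s → s < D * m → Σ LPt λ q → Within m q × Edge m s q
      edge-exists {s} 0≤s s<Dm with 0ℤ <? u m s | 0ℤ ≤? v m s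
      ... | no u≤0 | _ = q , (w₁ , ≤-reflexive (sym w₂) , w₃) , edge₂ w₂ refl
        where
        q = (- m , s)
        w₁ = subst (0ℤ ≤_) (identity₁ a p r m s) (neg-mono-≤ (≮⇒≥ u≤0))
          where
          identity₁ : ∀ a p r m s →
            - (r * p * s - (1ℤ + a + p) * m) ≡ m - (a + p) * - m - r * p * s
          identity₁ = ℤ-Solver.solve-∀
        w₂ = +-inverseˡ m
        w₃ = subst (0ℤ ≤_) (identity₃ r m s) (nonneg-* (<⇒≤ 0<r) 0≤s)
          where
          identity₃ : ∀ r m s → r * s ≡ - m + r * s + m
          identity₃ = ℤ-Solver.solve-∀
      ... | yes 0<u | yes 0≤v =
        q , (≤-reflexive (sym w₁) , <⇒≤ w₂ , w₃) , edge₁ w₂ w₁ (sym w₄)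
        where
        q = (r * p * s - (1ℤ + N) * m , D * a * m - (a + p) * s)
        w₁ = ≡-mod m square (identity₁ D a p r m s)
          where
          identity₁ : ∀ D a p r m s → let N = 1ℤ + a + p in
            m - (a + p) * (r * p * s - (1ℤ + N) * m) - r * p * (D * a * m - (a + p) * s)
            ≡ 0ℤ + m * (N * N - D * r * a * p)
          identity₁ = ℤ-Solver.solve-∀
        w₂ = subst (0ℤ <_) (identity₂ a p r m s) 0<u
          where
          identity₂ : ∀ a p r m s → let N = 1ℤ + a + p in
            r * p * s - N * m ≡ r * p * s - (1ℤ + N) * m + m
          identity₂ = ℤ-Solver.solve-∀
        w₃ = subst (0ℤ ≤_) (identity₃ D a p r m s) 0≤v
          where
          identity₃ : ∀ D a p r m s → let N = 1ℤ + a + p in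
            r * a * (D * m - s) - N * m
            ≡ r * p * s - (1ℤ + N) * m + r * (D * a * m - (a + p) * s) + m
          identity₃ = ℤ-Solver.solve-∀
        w₄ = ≡-mod (- s) square (identity₄ D a p r m s)
          where
          identity₄ : ∀ D a p r m s → let N = 1ℤ + a + p in
            D * a * (r * p * s - (1ℤ + N) * m) + (1ℤ + N) * (D * a * m - (a + p) * s)
            ≡ s + - s * (N * N - D * r * a * p)
          identity₄ = ℤ-Solver.solve-∀
      ... | yes 0<u | no v<0 =
        q , (<⇒≤ w₁ , <⇒≤ w₂ , ≤-reflexive (sym w₃)) , edge₃ w₂ w₁ w₃ (identity₄ D m s)
        where
        q = (r * (D * m - s) - m , - (D * m - s))
        w₁ = subst (0ℤ <_) (identity₁ D a p r m s) (neg-mono-< (≰⇒> v<0))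
          where
          identity₁ : ∀ D a p r m s → let z = D * m - s in
            - (r * a * z - (1ℤ + a + p) * m)
            ≡ m - (a + p) * (r * z - m) - r * p * - z
          identity₁ = ℤ-Solver.solve-∀
        w₂ = subst (0ℤ <_) (identity₂ D r m s) (pos-*⁺ 0<r (i<j⇒0<j-i s<Dm))
          where
          identity₂ : ∀ D r m s → r * (D * m - s) ≡ r * (D * m - s) - m + m
          identity₂ = ℤ-Solver.solve-∀
        w₃ = identity₃ D r m s
          where
          identity₃ : ∀ D r m s →
            r * (D * m - s) - m + r * - (D * m - s) + m ≡ 0ℤ
          identity₃ = ℤ-Solver.solve-∀
        identity₄ : ∀ D m s → s ≡ D * m + - (D * m - s)
        identity₄ = ℤ-Solver.solve-∀

      -- After multiplication by a positive constant, s and D m - s become nonnegative combinations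
      -- of slacks and `N * m`.
      edge-range : ∀ {s} q → Within m q → Edge m s q → (0ℤ ≤ s) × (s < D * m)
      edge-range {s} q@(x , y) (0≤h₁ , 0≤h₂ , 0≤h₃) (edge₂ on refl) =
        nonneg-*⁻ 0<r (subst (0ℤ ≤_) h₃≡ry 0≤h₃) ,
        0<j-i⇒i<j (pos-*⁻ (pos-*⁺ (pos-*⁺ 0<r 0<p) 0<a) (subst (0ℤ <_) (sym gap)
          (+-mono-<-≤ (pos-*⁺ 0<Nm (+-mono-< (+<+ (s≤s z≤n)) 0<p)) (nonneg-* (<⇒≤ 0<a) 0≤h₁))))
        where
        h₃≡ry = ≡-mod 1ℤ on (identity₁ r m x y)
          where
          identity₁ : ∀ r m x y → x + r * y + m ≡ r * y + 1ℤ * (x + m)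
          identity₁ = ℤ-Solver.solve-∀
        gap : r * p * a * (D * m - y) ≡ N * m * (1ℤ + p) + a * h₁ m q
        gap = ≡-mod (a * (a + p)) on (≡-mod (- m) square (identity₂ D a p r m x y))
          where
          identity₂ : ∀ D a p r m x y → let N = 1ℤ + a + p in
            r * p * a * (D * m - y)
            ≡ N * m * (1ℤ + p) + a * (m - (a + p) * x - r * p * y)
              + a * (a + p) * (x + m) + - m * (N * N - D * r * a * p)
          identity₂ = ℤ-Solver.solve-∀
      edge-range {s} q (0≤h₁ , 0≤h₂ , 0≤h₃) (edge₁ _ on e) =
        <⇒≤ (pos-*⁻ (pos-*⁺ 0<r 0<p) (subst (0ℤ <_) (recover-u (u-edge₁ q on e))
          (+-mono-≤-< 0≤h₂ 0<Nm))) ,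
        0<j-i⇒i<j (pos-*⁻ (pos-*⁺ 0<r 0<a) (subst (0ℤ <_) (recover-u (v-edge₁ q on e))
          (+-mono-≤-< 0≤h₃ 0<Nm)))
        where
        recover-u : ∀ {x y z} → x - z ≡ y → y + z ≡ x
        recover-u {x} {_} {z} refl = identity x z
          where
          identity : ∀ x z → x - z + z ≡ x
          identity = ℤ-Solver.solve-∀
      edge-range {s} q@(x , y) (0≤h₁ , 0≤h₂ , 0≤h₃) (edge₃ 0<h₂ 0<h₁ on e) =
        <⇒≤ (pos-*⁻ (pos-*⁺ 0<r 0<p) (subst (0ℤ <_) (identity₁ (r * p * s) (N * m))
          (+-mono-< (edge₃⇒0<u q 0<h₁ on e) 0<Nm))) ,
        -- Strictness of `h₂` excludes s = D m, which would be the vertex (-m , 0) again; that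
        -- vertex already has coordinate 0 on `edge₂`.
        0<j-i⇒i<j (pos-*⁻ 0<r (subst (0ℤ <_) (sym (gap e)) 0<h₂))
        where
        identity₁ : ∀ x z → x - z + z ≡ x
        identity₁ = ℤ-Solver.solve-∀
        gap : s ≡ D * m + y → r * (D * m - s) ≡ h₂ m q
        gap refl = ≡-mod (- 1ℤ) on (identity₂ D r m x y)
          where
          identity₂ : ∀ D r m x y →
            r * (D * m - (D * m + y)) ≡ x + m + - 1ℤ * (x + r * y + m)
          identity₂ = ℤ-Solver.solve-∀

    -- Passage from one dilate to the next.

    Strict : ℤ → LPt → Set
    Strict m q = (0ℤ < h₁ m q) × (0ℤ < h₂ m q) × (0ℤ < h₃ m q)

    edge⇒¬strict : ∀ {m s q} → Edge m s q → ¬ Strict m q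
    edge⇒¬strict (edge₂ on _) (_ , 0<h₂ , _) = <-irrefl (sym on) 0<h₂
    edge⇒¬strict (edge₁ _ on _) (0<h₁ , _) = <-irrefl (sym on) 0<h₁
    edge⇒¬strict (edge₃ _ _ on _) (_ , _ , 0<h₃) = <-irrefl (sym on) 0<h₃

    ¬strict⇒edge : ∀ {m} q → Within m q → ¬ Strict m q → Σ ℤ λ s → Edge m s q
    -- The slacks are tested in the order in which the edges claim a common vertex: `edge₂`, then
    -- `edge₁`, then `edge₃`.
    ¬strict⇒edge {m} q (0≤h₁ , 0≤h₂ , 0≤h₃) ¬strict with h₂ m q ≟ 0ℤ | h₁ m q ≟ 0ℤ | h₃ m q ≟ 0ℤ
    ... | yes on | _ | _ = _ , edge₂ on refl
    ... | no off | yes on | _ = _ , edge₁ (≤∧≢⇒< 0≤h₂ (off ∘ sym)) on refl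
    ... | no off | no off₁ | yes on =
      _ , edge₃ (≤∧≢⇒< 0≤h₂ (off ∘ sym)) (≤∧≢⇒< 0≤h₁ (off₁ ∘ sym)) on refl
    ... | no off | no off₁ | no off₃ = ⊥-elim (¬strict
      (≤∧≢⇒< 0≤h₁ (off₁ ∘ sym) , ≤∧≢⇒< 0≤h₂ (off ∘ sym) , ≤∧≢⇒< 0≤h₃ (off₃ ∘ sym)))

    within-suc : ∀ {m q} → Within m q → Within (1ℤ + m) q
    within-suc {m} {q} (0≤h₁ , 0≤h₂ , 0≤h₃) =
      subst (0ℤ ≤_) (sym (h₁-suc m q)) (+-mono-≤ {0ℤ} {1ℤ} (+≤+ z≤n) 0≤h₁) ,
      subst (0ℤ ≤_) (sym (h₂-suc m q)) (+-mono-≤ {0ℤ} {1ℤ} (+≤+ z≤n) 0≤h₂) ,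
      subst (0ℤ ≤_) (sym (h₃-suc m q)) (+-mono-≤ {0ℤ} {1ℤ} (+≤+ z≤n) 0≤h₃)

    -- Every slack is an integer and grows by exactly 1 with the level. With the converse below, the
    -- interior lattice points of one dilate are all the lattice points of the previous one.
    within⇒strict-suc : ∀ {m q} → Within m q → Strict (1ℤ + m) q
    within⇒strict-suc {m} {q} (0≤h₁ , 0≤h₂ , 0≤h₃) =
      subst (0ℤ <_) (sym (h₁-suc m q)) (+-mono-<-≤ {0ℤ} {1ℤ} (+<+ (s≤s z≤n)) 0≤h₁) ,
      subst (0ℤ <_) (sym (h₂-suc m q)) (+-mono-<-≤ {0ℤ} {1ℤ} (+<+ (s≤s z≤n)) 0≤h₂) ,
      subst (0ℤ <_) (sym (h₃-suc m q)) (+-mono-<-≤ {0ℤ} {1ℤ} (+<+ (s≤s z≤n)) 0≤h₃)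

    strict-suc⇒within : ∀ {m q} → Strict (1ℤ + m) q → Within m q
    strict-suc⇒within {m} {q} (0<h₁ , 0<h₂ , 0<h₃) =
      0<suc⇒0≤ (subst (0ℤ <_) (h₁-suc m q) 0<h₁) ,
      0<suc⇒0≤ (subst (0ℤ <_) (h₂-suc m q) 0<h₂) ,
      0<suc⇒0≤ (subst (0ℤ <_) (h₃-suc m q) 0<h₃)

    strict? : ∀ m q → Dec (Strict m q)
    strict? m q = (0ℤ <? h₁ m q) ×-dec (0ℤ <? h₂ m q) ×-dec (0ℤ <? h₃ m q)

    -- By `slack-sum` the weighted slacks add up to 0, so each of them is 0; then `h₂` gives x = 0
    -- and `h₃` gives y = 0.
    within-zero : ∀ q → Within 0ℤ q → q ≡ (0ℤ , 0ℤ)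
    within-zero q@(x , y) (0≤h₁ , 0≤h₂ , 0≤h₃) = cong₂ _,_ x≡0 y≡0
      where
      sum≡0 : h₁ 0ℤ q + p * h₃ 0ℤ q + a * h₂ 0ℤ q ≡ 0ℤ
      sum≡0 = trans (slack-sum 0ℤ q) (*-zeroʳ N)
      0≤ph₃ = nonneg-* (<⇒≤ 0<p) 0≤h₃
      h₂≡0 : h₂ 0ℤ q ≡ 0ℤ
      h₂≡0 = ≤-antisym (≮⇒≥ λ 0<h₂ → <-irrefl (sym sum≡0)
        (+-mono-≤-< (+-mono-≤ 0≤h₁ 0≤ph₃) (pos-*⁺ 0<a 0<h₂))) 0≤h₂
      h₃≡0 : h₃ 0ℤ q ≡ 0ℤ
      h₃≡0 = ≤-antisym (≮⇒≥ λ 0<h₃ → <-irrefl (sym sum≡0)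
        (+-mono-<-≤ (+-mono-≤-< 0≤h₁ (pos-*⁺ 0<p 0<h₃)) (nonneg-* (<⇒≤ 0<a) 0≤h₂))) 0≤h₃
      x≡0 : x ≡ 0ℤ
      x≡0 = trans (sym (+-identityʳ x)) h₂≡0
      y≡0 : y ≡ 0ℤ
      y≡0 = *-cancelˡ-≡ r y 0ℤ {{>-nonZero 0<r}}
        (trans (identity r x y) (trans (cong₂ _-_ h₃≡0 h₂≡0) (sym (*-zeroʳ r))))
        where
        identity : ∀ r x y → r * y ≡ x + r * y + 0ℤ - (x + 0ℤ)
        identity = ℤ-Solver.solve-∀

    zero-within : Within 0ℤ (0ℤ , 0ℤ)
    zero-within = ≤-reflexive (identity₁ a p r) , ≤-refl , ≤-reflexive (identity₂ r)
      where
      identity₁ : ∀ a p r → 0ℤ ≡ 0ℤ - (a + p) * 0ℤ - r * p * 0ℤ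
      identity₁ = ℤ-Solver.solve-∀
      identity₂ : ∀ r → 0ℤ ≡ 0ℤ + r * 0ℤ + 0ℤ
      identity₂ = ℤ-Solver.solve-∀

open LatticeGeometry using (nonneg-*⁻; pos-*⁺; pos-*⁻; module Levels)
open Equivalence using (to; from)

-- Cardinalities of sets of lattice points.

card-cong : ∀ {P Q : LPt → Set} {n} → (∀ q → P q ⇔ Q q) → HasCard P n → HasCard Q n
card-cong P⇔Q (xs , unique , length , member) =
  xs , unique , length ,
  λ q → mk⇔ (to (P⇔Q q) ∘ to (member q)) (from (member q) ∘ from (P⇔Q q))

card-⊎ : ∀ {P Q : LPt → Set} {m n} → (∀ q → P q → ¬ Q q) →
         HasCard P m → HasCard Q n → HasCard (λ q → P q ⊎ Q q) (m ℕ.+ n)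
card-⊎ disjoint (xs , unique , length , member) (xs′ , unique′ , length′ , member′) =
  xs ++ xs′ ,
  ++⁺ unique unique′ (λ {q} (∈xs , ∈xs′) → disjoint q (to (member q) ∈xs) (to (member′ q) ∈xs′)) ,
  trans (length-++ xs) (cong₂ ℕ._+_ length length′) ,
  λ q → mk⇔ (map (to (member q)) (to (member′ q)) ∘ ∈-++⁻ xs)
            [ ∈-++⁺ˡ ∘ from (member q) , ∈-++⁺ʳ xs ∘ from (member′ q) ]′

card-enumeration : ∀ {P : LPt → Set} {n} (f : Fin n → LPt) → (∀ {i j} → f i ≡ f j → i ≡ j) →
                   (∀ i → P (f i)) → (∀ q → P q → ∃ λ i → q ≡ f i) → HasCard P n
card-enumeration {P} f injective sound complete =
  tabulate f , tabulate⁺ injective , length-tabulate f ,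
  λ q → mk⇔ (λ q∈ → let i , q≡ = ∈-tabulate⁻ q∈ in subst P (sym q≡) (sound i))
            (λ Pq → let i , q≡ = complete q Pq in subst (_∈ tabulate f) (sym q≡) (∈-tabulate⁺ i))

card-singleton : ∀ {P : LPt → Set} q → P q → (∀ q′ → P q′ → q′ ≡ q) → HasCard P 1
card-singleton {P} q Pq unique =
  q ∷ [] , All.[] AllPairs.∷ AllPairs.[] , refl ,
  λ q′ → mk⇔ (λ { (here refl) → Pq }) (here ∘ unique q′)

-- The number of lattice points in a dilate.

ehrhart : ℕ → ℕ → ℕ
ehrhart D zero    = 1
ehrhart D (suc t) = ehrhart D t ℕ.+ D ℕ.* suc t

module Counting (D r a p : ℕ)
  .{{_ : ℕ.NonZero D}} .{{_ : ℕ.NonZero r}} .{{_ : ℕ.NonZero a}} .{{_ : ℕ.NonZero p}}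
  (square : (1 ℕ.+ a ℕ.+ p) ℕ.* (1 ℕ.+ a ℕ.+ p) ≡ D ℕ.* r ℕ.* a ℕ.* p) where

  0<+ : ∀ n .{{_ : ℕ.NonZero n}} → 0ℤ ℤ.< + n
  0<+ n = +<+ (ℕ.>-nonZero⁻¹ n)

  squareℤ : (1ℤ ℤ.+ + a ℤ.+ + p) ℤ.* (1ℤ ℤ.+ + a ℤ.+ + p) ℤ.- + D ℤ.* + r ℤ.* + a ℤ.* + p ≡ 0ℤ
  squareℤ = ℤ.i≡j⇒i-j≡0 (begin
    + N ℤ.* + N                    ≡⟨ ℤ.pos-* N N ⟨
    + (N ℕ.* N)                    ≡⟨ cong +_ square ⟩
    + (D ℕ.* r ℕ.* a ℕ.* p)        ≡⟨ ℤ.pos-* (D ℕ.* r ℕ.* a) p ⟩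
    + (D ℕ.* r ℕ.* a) ℤ.* + p      ≡⟨ cong (ℤ._* + p) (ℤ.pos-* (D ℕ.* r) a) ⟩
    + (D ℕ.* r) ℤ.* + a ℤ.* + p    ≡⟨ cong (λ w → w ℤ.* + a ℤ.* + p) (ℤ.pos-* D r) ⟩
    + D ℤ.* + r ℤ.* + a ℤ.* + p    ∎)
    where
    open ≡-Reasoning
    N = 1 ℕ.+ a ℕ.+ p

  open Levels (+ D) (+ r) (+ a) (+ p) (0<+ r) (0<+ a) (0<+ p) squareℤ public

  -- Indexing by the predecessor makes the level positive by construction: `Shell 0` is the boundary
  -- of T itself.
  Shell : ℕ → LPt → Set
  Shell m q = Within (+ suc m) q × ¬ Strict (+ suc m) q

  -- The edge coordinate is a bijection onto the integers from 0 to D (m + 1) - 1: `edge-exists`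
  -- inverts it, and `edge-functional` shows that no boundary point is missed.
  card-shell : ∀ m → HasCard (Shell m) (D ℕ.* suc m)
  card-shell m = card-enumeration point injective sound complete
    where
    0<m : 0ℤ ℤ.< + suc m
    0<m = 0<+ (suc m)
    in-range : ∀ (i : Fin (D ℕ.* suc m)) → + toℕ i ℤ.< + D ℤ.* + suc m
    in-range i = subst (+ toℕ i ℤ.<_) (ℤ.pos-* D (suc m)) (+<+ (toℕ<n i))
    witness : ∀ i → Σ LPt λ q → Within (+ suc m) q × Edge (+ suc m) (+ toℕ i) q
    witness i = edge-exists 0<m (+≤+ z≤n) (in-range i)
    point : Fin (D ℕ.* suc m) → LPt
    point = proj₁ ∘ witness
    injective : ∀ {i j} → point i ≡ point j → i ≡ j
    injective {i} {j} eq = toℕ-injective (ℤ.+-injective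
      (edge-injective (subst (Edge _ _) eq (proj₂ (proj₂ (witness i)))) (proj₂ (proj₂ (witness j)))))
    sound : ∀ i → Shell m (point i)
    sound i = let _ , within , edge = witness i in within , edge⇒¬strict edge
    complete : ∀ q → Shell m q → ∃ λ i → q ≡ point i
    complete q (within , ¬strict) with ¬strict⇒edge q within ¬strict
    ... | s , edge with edge-range 0<m q within edge
    -- A negative coordinate is impossible here, since `edge-range` makes it nonnegative.
    complete q (within , ¬strict) | + k , edge | _ , k< =
      i , edge-functional 0<m q (point i) within (proj₁ (proj₂ (witness i)))
            (subst (λ n → Edge _ (+ n) q) (sym (toℕ-fromℕ< k<D)) edge) (proj₂ (proj₂ (witness i)))
      where
      k<D : k ℕ.< D ℕ.* suc m
      k<D = ℤ.drop‿+<+ (subst (+ k ℤ.<_) (sym (ℤ.pos-* D (suc m))) k<)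
      i = fromℕ< k<D

  -- The points that are strict at level t + 1 are those of level t; the others form the shell.
  card-within : ∀ t → HasCard (Within (+ t)) (ehrhart D t)
  card-within zero    = card-singleton (0ℤ , 0ℤ) zero-within within-zero
  card-within (suc t) = card-cong
    (λ q → mk⇔ [ within-suc {+ t} {q} , proj₁ ]′ (split q))
    (card-⊎ (λ q within (_ , ¬strict) → ¬strict (within⇒strict-suc {+ t} {q} within))
      (card-within t) (card-shell t))
    where
    split : ∀ q → Within (+ suc t) q → Within (+ t) q ⊎ Shell t q
    split q within with strict? (+ suc t) q
    ... | yes strict = inj₁ (strict-suc⇒within {+ t} {q} strict)
    ... | no ¬strict = inj₂ (within , ¬strict)

-- Integers and order in the rationals.

open import Data.Rational
open import Data.Rational.Properties

ℚ-ring : AlmostCommutativeRing 0ℓ 0ℓ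
ℚ-ring = fromCommutativeRing +-*-commutativeRing λ x → dec⇒maybe (0ℚ ≟ x)

-- The quotient `i / 1` is normalised by a gcd and does not compute for a variable i. Rewriting it
-- to an explicit `mkℚ` exposes the numerator to the lemmas below.
ι-mkℚ : ∀ i → ι i ≡ mkℚ i 0 (Coprimality.sym (Coprimality.1-coprimeTo ℤ.∣ i ∣))
ι-mkℚ i = ↥p/↧p≡p (mkℚ i 0 _)

ι-+ : ∀ i j → ι (i ℤ.+ j) ≡ ι i + ι j
ι-+ i j rewrite ι-mkℚ i | ι-mkℚ j =
  cong ι (sym (cong₂ ℤ._+_ (ℤ.*-identityʳ i) (ℤ.*-identityʳ j)))

ι-* : ∀ i j → ι (i ℤ.* j) ≡ ι i * ι j
ι-* i j rewrite ι-mkℚ i | ι-mkℚ j = refl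

ι-neg : ∀ i → ι (ℤ.- i) ≡ - ι i
ι-neg i rewrite ι-mkℚ i | ι-mkℚ (ℤ.- i) = neg-mkℚ i
  where
  neg-mkℚ : ∀ i → mkℚ (ℤ.- i) 0 (Coprimality.sym (Coprimality.1-coprimeTo ℤ.∣ ℤ.- i ∣))
                ≡ - mkℚ i 0 (Coprimality.sym (Coprimality.1-coprimeTo ℤ.∣ i ∣))
  neg-mkℚ (+ zero)  = refl
  neg-mkℚ (+ suc n) = refl
  neg-mkℚ -[1+ n ]  = refl

ι-- : ∀ i j → ι (i ℤ.- j) ≡ ι i - ι j
ι-- i j = trans (ι-+ i (ℤ.- j)) (cong (_+_ (ι i)) (ι-neg j))

ι-injective : ∀ {i j} → ι i ≡ ι j → i ≡ j
ι-injective {i} {j} eq = cong ↥_ (trans (sym (ι-mkℚ i)) (trans eq (ι-mkℚ j)))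

ι-nonneg⁺ : ∀ {i} → 0ℤ ℤ.≤ i → 0ℚ ≤ ι i
ι-nonneg⁺ {i} 0≤i rewrite ι-mkℚ i = *≤* (subst (0ℤ ℤ.≤_) (sym (ℤ.*-identityʳ i)) 0≤i)

ι-nonneg⁻ : ∀ {i} → 0ℚ ≤ ι i → 0ℤ ℤ.≤ i
ι-nonneg⁻ {i} 0≤ιi rewrite ι-mkℚ i = subst (0ℤ ℤ.≤_) (ℤ.*-identityʳ i) (drop-*≤* 0≤ιi)

ι-pos⁺ : ∀ {i} → 0ℤ ℤ.< i → 0ℚ < ι i
ι-pos⁺ {i} 0<i rewrite ι-mkℚ i = *<* (subst (0ℤ ℤ.<_) (sym (ℤ.*-identityʳ i)) 0<i)

ι-pos⁻ : ∀ {i} → 0ℚ < ι i → 0ℤ ℤ.< i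
ι-pos⁻ {i} 0<ιi rewrite ι-mkℚ i = subst (0ℤ ℤ.<_) (ℤ.*-identityʳ i) (drop-*<* 0<ιi)

≡-mod : ∀ {x y e} c → e ≡ 0ℚ → x ≡ y + c * e → x ≡ y
≡-mod {y = y} c refl eq = trans eq (trans (cong (_+_ y) (*-zeroʳ c)) (+-identityʳ y))

-- The inverse is specified by an equation with right side 0, the form that `≡-mod` takes.
reciprocal : ∀ {q} → 0ℚ < q → Σ ℚ λ κ → (0ℚ < κ) × (q * κ - 1ℚ ≡ 0ℚ)
reciprocal {q} 0<q =
  1/ q , positive⁻¹ (1/ q) {{1/pos⇒pos q}} , trans (cong (_- 1ℚ) (*-inverseʳ q)) (+-inverseʳ 1ℚ)
  where instance
    q-pos : Positive q
    q-pos = positive 0<q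
    q-nonZero : NonZero q
    q-nonZero = pos⇒nonZero q

nonneg-* : ∀ {x y} → 0ℚ ≤ x → 0ℚ ≤ y → 0ℚ ≤ x * y
nonneg-* {x} {y} 0≤x 0≤y =
  subst (_≤ x * y) (*-zeroʳ x) (*-monoˡ-≤-nonNeg x {{nonNegative 0≤x}} 0≤y)

pos-* : ∀ {x y} → 0ℚ < x → 0ℚ < y → 0ℚ < x * y
pos-* {x} {y} 0<x 0<y =
  subst (_< x * y) (*-zeroʳ x) (*-monoʳ-<-pos x {{positive 0<x}} 0<y)

dilate-1 : ∀ T → dilate 1ℚ T ≡ T
dilate-1 (tri u v w) = cong₂ (λ { u′ (v′ , w′) → tri u′ v′ w′ }) (·-1 u) (cong₂ _,_ (·-1 v) (·-1 w))
  where
  ·-1 : ∀ v → 1ℚ · v ≡ v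
  ·-1 (x , y) = cong₂ _,_ (*-identityˡ x) (*-identityˡ y)

IsComb-cong : ∀ T q {l₁ l₂ l₃ l₁′ l₂′ l₃′} → l₁ ≡ l₁′ → l₂ ≡ l₂′ → l₃ ≡ l₃′ →
              IsComb T l₁ l₂ l₃ q → IsComb T l₁′ l₂′ l₃′ q
IsComb-cong T q refl refl refl comb = comb

-- Barycentric coordinates in the triangle.

module Barycentric (r a p w : ℚ) (rapw≡N : r * a * p * w - (1ℚ + a + p) ≡ 0ℚ) where

  -- Here w stands for N / (r a p). All coordinates are then polynomials, and the ring solver works
  -- modulo `rapw≡N` without division.
  T : Triangle
  T = tri (- 1ℚ , 0ℚ) (- 1ℚ , a * w) (r * (p * w) - 1ℚ , - (p * w))

  N : ℚ
  N = 1ℚ + a + p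

  g₁ g₂ g₃ : ℚ → Pt → ℚ
  g₁ τ (x , y) = τ - (a + p) * x - r * p * y
  g₂ τ (x , y) = x + τ
  g₃ τ (x , y) = x + r * y + τ

  module _ {τ l₁ l₂ l₃ : ℚ} where

    -- Each slack vanishes at both ends of its edge, so on an affine combination it is proportional
    -- to the weight of the opposite vertex. That vertex is the first for `g₁`, the second for `g₃`
    -- and the third for `g₂`.
    comb⇒g₁ : ∀ {q} → IsComb (dilate τ T) l₁ l₂ l₃ q → g₁ τ q ≡ N * τ * l₁
    comb⇒g₁ (sum , refl , refl) =
      ≡-mod (- τ) (trans (cong (_- 1ℚ) sum) (+-inverseʳ 1ℚ))
      (≡-mod (- (τ * (l₂ + l₃))) rapw≡N (identity r a p w τ l₁ l₂ l₃))
      where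
      identity : ∀ r a p w τ l₁ l₂ l₃ → let N = 1ℚ + a + p in
        τ - (a + p) * (l₁ * (τ * - 1ℚ) + l₂ * (τ * - 1ℚ) + l₃ * (τ * (r * (p * w) - 1ℚ)))
          - r * p * (l₁ * (τ * 0ℚ) + l₂ * (τ * (a * w)) + l₃ * (τ * - (p * w)))
        ≡ N * τ * l₁ + - τ * (l₁ + l₂ + l₃ - 1ℚ) + - (τ * (l₂ + l₃)) * (r * a * p * w - N)
      identity = solve-∀ ℚ-ring

    comb⇒g₃ : ∀ {q} → IsComb (dilate τ T) l₁ l₂ l₃ q → p * g₃ τ q ≡ N * τ * l₂
    comb⇒g₃ (sum , refl , refl) =
      ≡-mod (- (p * τ)) (trans (cong (_- 1ℚ) sum) (+-inverseʳ 1ℚ))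
      (≡-mod (τ * l₂) rapw≡N (identity r a p w τ l₁ l₂ l₃))
      where
      identity : ∀ r a p w τ l₁ l₂ l₃ → let N = 1ℚ + a + p in
        p * (l₁ * (τ * - 1ℚ) + l₂ * (τ * - 1ℚ) + l₃ * (τ * (r * (p * w) - 1ℚ))
          + r * (l₁ * (τ * 0ℚ) + l₂ * (τ * (a * w)) + l₃ * (τ * - (p * w))) + τ)
        ≡ N * τ * l₂ + - (p * τ) * (l₁ + l₂ + l₃ - 1ℚ) + τ * l₂ * (r * a * p * w - N)
      identity = solve-∀ ℚ-ring

    comb⇒g₂ : ∀ {q} → IsComb (dilate τ T) l₁ l₂ l₃ q → a * g₂ τ q ≡ N * τ * l₃
    comb⇒g₂ (sum , refl , refl) =
      ≡-mod (- (a * τ)) (trans (cong (_- 1ℚ) sum) (+-inverseʳ 1ℚ))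
      (≡-mod (τ * l₃) rapw≡N (identity r a p w τ l₁ l₂ l₃))
      where
      identity : ∀ r a p w τ l₁ l₂ l₃ → let N = 1ℚ + a + p in
        a * (l₁ * (τ * - 1ℚ) + l₂ * (τ * - 1ℚ) + l₃ * (τ * (r * (p * w) - 1ℚ)) + τ)
        ≡ N * τ * l₃ + - (a * τ) * (l₁ + l₂ + l₃ - 1ℚ) + τ * l₃ * (r * a * p * w - N)
      identity = solve-∀ ℚ-ring

  -- Converse of the three lemmas above, with κ the inverse of `N * τ`; that the weights add up to 1
  -- is `slack-sum` over the rationals.
  g⇒comb : ∀ {τ κ} q → N * τ * κ - 1ℚ ≡ 0ℚ →
           IsComb (dilate τ T) (κ * g₁ τ q) (κ * (p * g₃ τ q)) (κ * (a * g₂ τ q)) q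
  g⇒comb {τ} {κ} (x , y) Nτκ≡1 =
    ≡-mod 1ℚ Nτκ≡1 (sum-identity r a p τ κ x y) ,
    sym (≡-mod x Nτκ≡1 (≡-mod (κ * τ * (x + τ)) rapw≡N (x-identity r a p w τ κ x y))) ,
    sym (≡-mod y Nτκ≡1 (≡-mod (κ * τ * y) rapw≡N (y-identity r a p w τ κ x y)))
    where
    sum-identity : ∀ r a p τ κ x y →
      κ * (τ - (a + p) * x - r * p * y) + κ * (p * (x + r * y + τ)) + κ * (a * (x + τ))
      ≡ 1ℚ + 1ℚ * ((1ℚ + a + p) * τ * κ - 1ℚ)
    sum-identity = solve-∀ ℚ-ring
    x-identity : ∀ r a p w τ κ x y → let N = 1ℚ + a + p in
      κ * (τ - (a + p) * x - r * p * y) * (τ * - 1ℚ) + κ * (p * (x + r * y + τ)) * (τ * - 1ℚ)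
        + κ * (a * (x + τ)) * (τ * (r * (p * w) - 1ℚ))
      ≡ x + x * (N * τ * κ - 1ℚ) + κ * τ * (x + τ) * (r * a * p * w - N)
    x-identity = solve-∀ ℚ-ring
    y-identity : ∀ r a p w τ κ x y → let N = 1ℚ + a + p in
      κ * (τ - (a + p) * x - r * p * y) * (τ * 0ℚ) + κ * (p * (x + r * y + τ)) * (τ * (a * w))
        + κ * (a * (x + τ)) * (τ * - (p * w))
      ≡ y + y * (N * τ * κ - 1ℚ) + κ * τ * y * (r * a * p * w - N)
    y-identity = solve-∀ ℚ-ring

  det-T : det T ≡ - (r * p * w * (a * w))
  det-T = identity r a p w
    where
    identity : ∀ r a p w →
      (- 1ℚ - - 1ℚ) * (- (p * w) - 0ℚ) - (a * w - 0ℚ) * (r * (p * w) - 1ℚ - - 1ℚ)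
      ≡ - (r * p * w * (a * w))
    identity = solve-∀ ℚ-ring

-- Integrality of rationals and least witnesses.

Integral : ℚ → Set
Integral x = ∃ λ m → x ≡ ι m

integral-* : ∀ {x y} → Integral x → Integral y → Integral (x * y)
integral-* (m , refl) (n , refl) = m ℤ.* n , sym (ι-* m n)

integral-+ : ∀ {x y} → Integral x → Integral y → Integral (x + y)
integral-+ (m , refl) (n , refl) = m ℤ.+ n , sym (ι-+ m n)

integral-neg : ∀ {x} → Integral x → Integral (- x)
integral-neg (m , refl) = ℤ.- m , sym (ι-neg m)

-- A rational is an integer exactly when it equals its own numerator.
integral? : ∀ x → Dec (Integral x)
integral? x = map′ (λ eq → ↥ x , eq) (λ { (m , refl) → cong ι (sym (cong ↥_ (ι-mkℚ m))) }) (x ≟ ι (↥ x))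

integralTri? : ∀ T → Dec (IntegralTri T)
integralTri? (tri u v w) = integralPt? u ×-dec integralPt? v ×-dec integralPt? w
  where
  integralPt? : ∀ v → Dec (IntegralPt v)
  integralPt? (x , y) = integral? x ×-dec integral? y

least : ∀ {P : ℕ → Set} → (∀ n → Dec (P n)) → ∀ n → P n →
        ∃ λ m → P m × (∀ k → P k → m ℕ.≤ k)
least {P} P? = <-rec _ search
  where
  search : ∀ n → (∀ {m} → m ℕ.< n → P m → ∃ λ m → P m × (∀ k → P k → m ℕ.≤ k)) →
           P n → ∃ λ m → P m × (∀ k → P k → m ℕ.≤ k)
  search n smaller Pn with ℕ.anyUpTo? P? n
  ... | yes (m , m<n , Pm) = smaller m<n Pm
  ... | no none = n , Pn , λ k Pk → ℕ.≮⇒≥ λ k<n → none (k , k<n , Pk)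

-- In terms of w, the vertices other than (-1 , 0) are (-1 , a w) and (r p w - 1 , - p w).
apex : ∀ r a p .{{_ : ℕ.NonZero r}} .{{_ : ℕ.NonZero a}} .{{_ : ℕ.NonZero p}} →
  Σ ℚ λ w → ιℕ r * ιℕ a * ιℕ p * w - (1ℚ + ιℕ a + ιℕ p) ≡ 0ℚ
apex r a p = let κ , _ , rapκ≡1 = reciprocal 0<rap in
  N * κ , ≡-mod N rapκ≡1 (identity (ιℕ r * ιℕ a * ιℕ p) N κ)
  where
  N : ℚ
  N = 1ℚ + ιℕ a + ιℕ p
  0<ι : ∀ n .{{_ : ℕ.NonZero n}} → 0ℚ < ιℕ n
  0<ι n = ι-pos⁺ (+<+ (ℕ.>-nonZero⁻¹ n))
  0<rap : 0ℚ < ιℕ r * ιℕ a * ιℕ p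
  0<rap = pos-* (pos-* (0<ι r) (0<ι a)) (0<ι p)
  identity : ∀ q N κ → q * (N * κ) - N ≡ 0ℚ + N * (q * κ - 1ℚ)
  identity = solve-∀ ℚ-ring

Realisable : ℕ → ℤ → Set
Realisable b k = Σ Triangle λ T → Σ ℕ λ d →
  NonDegenerate T × Pseudointegral T × IsDenominator T d × (k ℤ.< + d) ×
  HasCard (λ p → InInterior T (ιP p)) 1 ×
  Σ ℕ λ nb → HasCard (λ p → OnBoundary T (ιP p)) nb × (+ nb ≡ + b)

-- Ehrhart polynomial and lattice points of the triangle of a solution.

module Family (D r a p : ℕ)
  .{{_ : ℕ.NonZero D}} .{{_ : ℕ.NonZero r}} .{{_ : ℕ.NonZero a}} .{{_ : ℕ.NonZero p}}
  (square : (1 ℕ.+ a ℕ.+ p) ℕ.* (1 ℕ.+ a ℕ.+ p) ≡ D ℕ.* r ℕ.* a ℕ.* p)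
  (w : ℚ) (rapw≡N : ιℕ r * ιℕ a * ιℕ p * w - (1ℚ + ιℕ a + ιℕ p) ≡ 0ℚ) where

  open Counting D r a p square hiding (N; 0<N)

  0<ι : ∀ n .{{_ : ℕ.NonZero n}} → 0ℚ < ιℕ n
  0<ι n = ι-pos⁺ (0<+ n)

  open Barycentric (ιℕ r) (ιℕ a) (ιℕ p) w rapw≡N

  0<N : 0ℚ < N
  0<N = +-mono-< (+-mono-< (0<ι 1) (0<ι a)) (0<ι p)

  ι-h₁ : ∀ t q → ι (h₁ (+ t) q) ≡ g₁ (ιℕ t) (ιP q)
  ι-h₁ t (x , y) =
    trans (ι-- (+ t ℤ.- (+ a ℤ.+ + p) ℤ.* x) (+ r ℤ.* + p ℤ.* y)) (cong₂ _-_
      (trans (ι-- (+ t) ((+ a ℤ.+ + p) ℤ.* x)) (cong (_-_ (ιℕ t))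
        (trans (ι-* (+ a ℤ.+ + p) x) (cong (_* ι x) (ι-+ (+ a) (+ p))))))
      (trans (ι-* (+ r ℤ.* + p) y) (cong (_* ι y) (ι-* (+ r) (+ p)))))

  ι-ah₂ : ∀ t q → ι (+ a ℤ.* h₂ (+ t) q) ≡ ιℕ a * g₂ (ιℕ t) (ιP q)
  ι-ah₂ t (x , y) = trans (ι-* (+ a) (x ℤ.+ + t)) (cong (_*_ (ιℕ a)) (ι-+ x (+ t)))

  ι-ph₃ : ∀ t q → ι (+ p ℤ.* h₃ (+ t) q) ≡ ιℕ p * g₃ (ιℕ t) (ιP q)
  ι-ph₃ t (x , y) = trans (ι-* (+ p) (x ℤ.+ + r ℤ.* y ℤ.+ + t)) (cong (_*_ (ιℕ p))
    (trans (ι-+ (x ℤ.+ + r ℤ.* y) (+ t)) (cong (_+ ιℕ t)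
      (trans (ι-+ x (+ r ℤ.* y)) (cong (_+_ (ι x)) (ι-* (+ r) y))))))

  module _ (t : ℕ) .{{_ : ℕ.NonZero t}} where

    0<Nt : 0ℚ < N * ιℕ t
    0<Nt = pos-* 0<N (0<ι t)

    Reciprocal : Set
    Reciprocal = Σ ℚ λ κ → (0ℚ < κ) × (N * ιℕ t * κ - 1ℚ ≡ 0ℚ)

    combination : ∀ {κ} q → N * ιℕ t * κ - 1ℚ ≡ 0ℚ →
      IsComb (dilate (ιℕ t) T) (κ * ι (h₁ (+ t) q))
        (κ * ι (+ p ℤ.* h₃ (+ t) q)) (κ * ι (+ a ℤ.* h₂ (+ t) q)) (ιP q)
    combination {κ} q Ntκ≡1 = IsComb-cong (dilate (ιℕ t) T) (ιP q)
      (cong (_*_ κ) (sym (ι-h₁ t q))) (cong (_*_ κ) (sym (ι-ph₃ t q)))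
      (cong (_*_ κ) (sym (ι-ah₂ t q))) (g⇒comb (ιP q) Ntκ≡1)

    inTri⇒within : ∀ q → InTri (dilate (ιℕ t) T) (ιP q) → Within (+ t) q
    inTri⇒within q (l₁ , l₂ , l₃ , 0≤l₁ , 0≤l₂ , 0≤l₃ , comb) =
      scaled l₁ 0≤l₁ (trans (ι-h₁ t q) (comb⇒g₁ {ιℕ t} {l₁} {l₂} {l₃} comb)) ,
      nonneg-*⁻ (0<+ a)
        (scaled l₃ 0≤l₃ (trans (ι-ah₂ t q) (comb⇒g₂ {ιℕ t} {l₁} {l₂} {l₃} comb))) ,
      nonneg-*⁻ (0<+ p)
        (scaled l₂ 0≤l₂ (trans (ι-ph₃ t q) (comb⇒g₃ {ιℕ t} {l₁} {l₂} {l₃} comb)))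
      where
      scaled : ∀ {i} l → 0ℚ ≤ l → ι i ≡ N * ιℕ t * l → 0ℤ ℤ.≤ i
      scaled l 0≤l eq = ι-nonneg⁻ (subst (0ℚ ≤_) (sym eq) (nonneg-* (<⇒≤ 0<Nt) 0≤l))

    inInterior⇒strict : ∀ q → InInterior (dilate (ιℕ t) T) (ιP q) → Strict (+ t) q
    inInterior⇒strict q (l₁ , l₂ , l₃ , 0<l₁ , 0<l₂ , 0<l₃ , comb) =
      scaled l₁ 0<l₁ (trans (ι-h₁ t q) (comb⇒g₁ {ιℕ t} {l₁} {l₂} {l₃} comb)) ,
      pos-*⁻ (0<+ a)
        (scaled l₃ 0<l₃ (trans (ι-ah₂ t q) (comb⇒g₂ {ιℕ t} {l₁} {l₂} {l₃} comb))) ,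
      pos-*⁻ (0<+ p)
        (scaled l₂ 0<l₂ (trans (ι-ph₃ t q) (comb⇒g₃ {ιℕ t} {l₁} {l₂} {l₃} comb)))
      where
      scaled : ∀ {i} l → 0ℚ < l → ι i ≡ N * ιℕ t * l → 0ℤ ℤ.< i
      scaled l 0<l eq = ι-pos⁻ (subst (0ℚ <_) (sym eq) (pos-* 0<Nt 0<l))

    within⇒inTri : ∀ q → Reciprocal → Within (+ t) q → InTri (dilate (ιℕ t) T) (ιP q)
    within⇒inTri q (κ , 0<κ , Ntκ≡1) (0≤h₁ , 0≤h₂ , 0≤h₃) =
      κ * ι (h₁ (+ t) q) , κ * ι (+ p ℤ.* h₃ (+ t) q) , κ * ι (+ a ℤ.* h₂ (+ t) q) ,
      scaled 0≤h₁ , scaled (LatticeGeometry.nonneg-* (ℤ.<⇒≤ (0<+ p)) 0≤h₃) ,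
      scaled (LatticeGeometry.nonneg-* (ℤ.<⇒≤ (0<+ a)) 0≤h₂) , combination q Ntκ≡1
      where
      scaled : ∀ {i} → 0ℤ ℤ.≤ i → 0ℚ ≤ κ * ι i
      scaled 0≤i = nonneg-* (<⇒≤ 0<κ) (ι-nonneg⁺ 0≤i)

    strict⇒inInterior : ∀ q → Reciprocal → Strict (+ t) q → InInterior (dilate (ιℕ t) T) (ιP q)
    strict⇒inInterior q (κ , 0<κ , Ntκ≡1) (0<h₁ , 0<h₂ , 0<h₃) =
      κ * ι (h₁ (+ t) q) , κ * ι (+ p ℤ.* h₃ (+ t) q) , κ * ι (+ a ℤ.* h₂ (+ t) q) ,
      scaled 0<h₁ , scaled (pos-*⁺ (0<+ p) 0<h₃) ,
      scaled (pos-*⁺ (0<+ a) 0<h₂) , combination q Ntκ≡1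
      where
      scaled : ∀ {i} → 0ℤ ℤ.< i → 0ℚ < κ * ι i
      scaled 0<i = pos-* 0<κ (ι-pos⁺ 0<i)

    inTri⇔within : ∀ q → InTri (dilate (ιℕ t) T) (ιP q) ⇔ Within (+ t) q
    inTri⇔within q = mk⇔ (inTri⇒within q) (within⇒inTri q (reciprocal 0<Nt))

    inInterior⇔strict : ∀ q → InInterior (dilate (ιℕ t) T) (ιP q) ⇔ Strict (+ t) q
    inInterior⇔strict q = mk⇔ (inInterior⇒strict q) (strict⇒inInterior q (reciprocal 0<Nt))

  pseudointegral : Pseudointegral T
  -- With c = D / 2, the sum 1 + D (1 + ... + t) equals 1 + c t + c t².
  pseudointegral = 1ℚ ∷ c ∷ c ∷ [] , λ t 1≤t →
    ehrhart D t ,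
    card-cong (λ q → mk⇔ (from (inTri⇔within t {{ℕ.>-nonZero 1≤t}} q))
                         (to (inTri⇔within t {{ℕ.>-nonZero 1≤t}} q)))
      (card-within t) ,
    polynomial t
    where
    c : ℚ
    c = ιℕ D * ½
    D≡c+c : ιℕ D ≡ c + c
    D≡c+c = trans (sym (*-identityʳ (ιℕ D))) (*-distribˡ-+ (ιℕ D) ½ ½)
    polynomial : ∀ t → ιℕ (ehrhart D t) ≡ evalPoly (1ℚ ∷ c ∷ c ∷ []) (ιℕ t)
    polynomial zero = identity c
      where
      identity : ∀ c → 1ℚ ≡ 1ℚ + 0ℚ * (c + 0ℚ * (c + 0ℚ * 0ℚ))
      identity = solve-∀ ℚ-ring
    polynomial (suc t) = begin
      ιℕ (ehrhart D t ℕ.+ D ℕ.* suc t)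
        ≡⟨ ι-+ (+ ehrhart D t) (+ (D ℕ.* suc t)) ⟩
      ιℕ (ehrhart D t) + ιℕ (D ℕ.* suc t)
        ≡⟨ cong₂ _+_ (polynomial t) (trans (cong ι (ℤ.pos-* D (suc t))) (ι-* (+ D) (+ suc t))) ⟩
      evalPoly (1ℚ ∷ c ∷ c ∷ []) (ιℕ t) + ιℕ D * ιℕ (suc t)
        ≡⟨ cong₂ (λ d τ → evalPoly (1ℚ ∷ c ∷ c ∷ []) (ιℕ t) + d * τ) D≡c+c (ι-+ 1ℤ (+ t)) ⟩
      evalPoly (1ℚ ∷ c ∷ c ∷ []) (ιℕ t) + (c + c) * (1ℚ + ιℕ t)
        ≡⟨ identity c (ιℕ t) ⟩
      evalPoly (1ℚ ∷ c ∷ c ∷ []) (1ℚ + ιℕ t)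
        ≡⟨ cong (evalPoly (1ℚ ∷ c ∷ c ∷ [])) (ι-+ 1ℤ (+ t)) ⟨
      evalPoly (1ℚ ∷ c ∷ c ∷ []) (ιℕ (suc t)) ∎
      where
      open ≡-Reasoning
      identity : ∀ c τ →
        1ℚ + τ * (c + τ * (c + τ * 0ℚ)) + (c + c) * (1ℚ + τ)
        ≡ 1ℚ + (1ℚ + τ) * (c + (1ℚ + τ) * (c + (1ℚ + τ) * 0ℚ))
      identity = solve-∀ ℚ-ring

  inTri₁ : ∀ q → InTri T (ιP q) ⇔ Within 1ℤ q
  inTri₁ q = subst (λ T′ → InTri T′ (ιP q) ⇔ Within 1ℤ q) (dilate-1 T) (inTri⇔within 1 q)

  inInterior₁ : ∀ q → InInterior T (ιP q) ⇔ Strict 1ℤ q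
  inInterior₁ q = subst (λ T′ → InInterior T′ (ιP q) ⇔ Strict 1ℤ q) (dilate-1 T) (inInterior⇔strict 1 q)

  -- Strict points at level 1 are the points of level 0, that is, the origin alone.
  card-interior : HasCard (λ q → InInterior T (ιP q)) 1
  card-interior = card-cong
    (λ q → mk⇔ (from (inInterior₁ q) ∘ within⇒strict-suc {0ℤ} {q})
               (strict-suc⇒within {0ℤ} {q} ∘ to (inInterior₁ q)))
    (card-within 0)

  card-boundary : HasCard (λ q → OnBoundary T (ιP q)) (D ℕ.* 1)
  card-boundary = card-cong
    (λ q → mk⇔
      (λ (within , ¬strict) → from (inTri₁ q) within , ¬strict ∘ to (inInterior₁ q))
      (λ (inTri , ¬inInterior) → to (inTri₁ q) inTri , ¬inInterior ∘ from (inInterior₁ q)))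
    (card-shell 0)

  nonDegenerate : NonDegenerate T
  nonDegenerate det≡0 = <-irrefl (sym N²≡0) (pos-* 0<N 0<N)
    where
    rpw·aw≡0 : ιℕ r * ιℕ p * w * (ιℕ a * w) ≡ 0ℚ
    rpw·aw≡0 = neg-injective (trans (sym det-T) det≡0)
    -- The determinant is minus r p w · a w, and r a p times this product is (r a p w)² = N², so a
    -- zero determinant would make N² vanish.
    N²≡0 : N * N ≡ 0ℚ
    N²≡0 = ≡-mod (ιℕ r * ιℕ a * ιℕ p) rpw·aw≡0
      (≡-mod (- (N + ιℕ r * ιℕ a * ιℕ p * w)) rapw≡N (identity (ιℕ r) (ιℕ a) (ιℕ p) w))
      where
      identity : ∀ r a p w → let N = 1ℚ + a + p in
        N * N ≡ 0ℚ + r * a * p * (r * p * w * (a * w)) + - (N + r * a * p * w) * (r * a * p * w - N)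
      identity = solve-∀ ℚ-ring

  -- The denominator of the triangle.

  HasDenominator : ℕ → Set
  HasDenominator d = (1 ℕ.≤ d) × IntegralTri (dilate (ιℕ d) T)

  hasDenominator? : ∀ d → Dec (HasDenominator d)
  hasDenominator? d = (1 ℕ.≤? d) ×-dec integralTri? (dilate (ιℕ d) T)

  -- Each coordinate is linear in w with integral coefficients, and r a p w = N is an integer. This
  -- witness only starts the search for the least one.
  rap-hasDenominator : HasDenominator (r ℕ.* a ℕ.* p)
  rap-hasDenominator =
    ℕ.>-nonZero⁻¹ _ {{ℕ.m*n≢0 (r ℕ.* a) p {{ℕ.m*n≢0 r a}}}} ,
    (integral-* (int d) int-1 , integral-* (int d) (0ℤ , refl)) ,
    (integral-* (int d) int-1 ,
     subst Integral (sym aw-multiple) (integral-* (int a) int-N)) ,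
    (subst Integral (sym rpw-multiple)
       (integral-+ (integral-* (integral-* (int r) (int p)) int-N) (integral-neg (int d))) ,
     subst Integral (sym pw-multiple) (integral-neg (integral-* (int p) int-N)))
    where
    d : ℕ
    d = r ℕ.* a ℕ.* p
    int : ∀ n → Integral (ιℕ n)
    int n = + n , refl
    int-1 : Integral (- 1ℚ)
    int-1 = ℤ.- 1ℤ , refl
    int-N : Integral N
    int-N = integral-+ (integral-+ (1ℤ , refl) (int a)) (int p)
    d≡rap : ιℕ (r ℕ.* a ℕ.* p) ≡ ιℕ r * ιℕ a * ιℕ p
    d≡rap = begin
      ιℕ (r ℕ.* a ℕ.* p)      ≡⟨ cong ι (ℤ.pos-* (r ℕ.* a) p) ⟩
      ι (+ (r ℕ.* a) ℤ.* + p) ≡⟨ ι-* (+ (r ℕ.* a)) (+ p) ⟩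
      ιℕ (r ℕ.* a) * ιℕ p     ≡⟨ cong (λ x → ι x * ιℕ p) (ℤ.pos-* r a) ⟩
      ι (+ r ℤ.* + a) * ιℕ p  ≡⟨ cong (_* ιℕ p) (ι-* (+ r) (+ a)) ⟩
      ιℕ r * ιℕ a * ιℕ p      ∎
      where open ≡-Reasoning
    aw-multiple : ιℕ (r ℕ.* a ℕ.* p) * (ιℕ a * w) ≡ ιℕ a * N
    aw-multiple = trans (cong (_* (ιℕ a * w)) d≡rap)
      (≡-mod (ιℕ a) rapw≡N (identity (ιℕ r) (ιℕ a) (ιℕ p) w))
      where
      identity : ∀ r a p w → let N = 1ℚ + a + p in
        r * a * p * (a * w) ≡ a * N + a * (r * a * p * w - N)
      identity = solve-∀ ℚ-ring
    rpw-multiple : ιℕ (r ℕ.* a ℕ.* p) * (ιℕ r * (ιℕ p * w) - 1ℚ)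
                   ≡ ιℕ r * ιℕ p * N + - ιℕ (r ℕ.* a ℕ.* p)
    rpw-multiple = ≡-mod (ιℕ r * ιℕ p) rapw≡N
      (trans (cong (_* (ιℕ r * (ιℕ p * w) - 1ℚ)) d≡rap)
        (trans (identity (ιℕ r) (ιℕ a) (ιℕ p) w)
          (cong (λ d → ιℕ r * ιℕ p * N + - d + ιℕ r * ιℕ p * (ιℕ r * ιℕ a * ιℕ p * w - N)) (sym d≡rap))))
      where
      identity : ∀ r a p w → let N = 1ℚ + a + p in
        r * a * p * (r * (p * w) - 1ℚ)
        ≡ r * p * N + - (r * a * p) + r * p * (r * a * p * w - N)
      identity = solve-∀ ℚ-ring
    pw-multiple : ιℕ (r ℕ.* a ℕ.* p) * - (ιℕ p * w) ≡ - (ιℕ p * N)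
    pw-multiple = trans (cong (_* - (ιℕ p * w)) d≡rap)
      (≡-mod (- ιℕ p) rapw≡N (identity (ιℕ r) (ιℕ a) (ιℕ p) w))
      where
      identity : ∀ r a p w → let N = 1ℚ + a + p in
        r * a * p * - (p * w) ≡ - (p * N) + - p * (r * a * p * w - N)
      identity = solve-∀ ℚ-ring

  -- a (a + 2) ≡ -1 modulo p, so p is coprime to a and survives in the denominator of a w.
  p∣d²D : ∀ d → HasDenominator d → p ℕ.∣ d ℕ.* d ℕ.* D
  p∣d²D d (_ , _ , (_ , m , daw≡m) , _) = subst (p ℕ.∣_) abs-d²D
    (∣⇒∣ᵤ (divides quotient (≡-modℤ (+ d ℤ.* + d ℤ.* + D) squareℤ
      (≡-modℤ (ℤ.- (+ a ℤ.+ + 2)) reduced (identity (+ D) (+ r) (+ a) (+ p) (+ d) m)))))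
    where
    ≡-modℤ = LatticeGeometry.≡-mod
    Nℤ quotient : ℤ
    Nℤ = 1ℤ ℤ.+ + a ℤ.+ + p
    -- Write d² D = (a + 1)² d² D - (a + 2) a d² D. Modulo p the first term vanishes since (a + 1)²
    -- = (N - p)² and N² = D r a p, the second by `reduced`; the quotient collects the multiples of
    -- p.
    quotient = (+ D ℤ.* + r ℤ.* + a ℤ.- + 2 ℤ.* Nℤ ℤ.+ + p) ℤ.* (+ d ℤ.* + d ℤ.* + D)
               ℤ.- m ℤ.* m ℤ.* + r ℤ.* (+ a ℤ.+ + 2)
    abs-d²D : ℤ.∣ + d ℤ.* + d ℤ.* + D ∣ ≡ d ℕ.* d ℕ.* D
    abs-d²D = trans (ℤ.abs-* (+ d ℤ.* + d) (+ D)) (cong (ℕ._* D) (ℤ.abs-* (+ d) (+ d)))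
    -- The second vertex gives d a w = m, and a w = N / (r p).
    dN≡mrp : + d ℤ.* Nℤ ℤ.- m ℤ.* (+ r ℤ.* + p) ≡ 0ℤ
    dN≡mrp = ℤ.i≡j⇒i-j≡0 (ι-injective {+ d ℤ.* Nℤ} {m ℤ.* (+ r ℤ.* + p)} (begin
      ι (+ d ℤ.* Nℤ)
        ≡⟨ ι-* (+ d) Nℤ ⟩
      ιℕ d * ι Nℤ
        ≡⟨ cong (_*_ (ιℕ d)) (trans (ι-+ (1ℤ ℤ.+ + a) (+ p)) (cong (_+ ιℕ p) (ι-+ 1ℤ (+ a)))) ⟩
      ιℕ d * N
        ≡⟨ ≡-mod (- ιℕ d) rapw≡N (dN-identity (ιℕ r) (ιℕ a) (ιℕ p) w (ιℕ d)) ⟩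
      ιℕ d * (ιℕ a * w) * (ιℕ r * ιℕ p)
        ≡⟨ cong₂ _*_ daw≡m (sym (ι-* (+ r) (+ p))) ⟩
      ι m * ι (+ r ℤ.* + p)
        ≡⟨ ι-* m (+ r ℤ.* + p) ⟨
      ι (m ℤ.* (+ r ℤ.* + p)) ∎))
      where
      open ≡-Reasoning
      dN-identity : ∀ r a p w d → let N = 1ℚ + a + p in
        d * N ≡ d * (a * w) * (r * p) + - d * (r * a * p * w - N)
      dN-identity = solve-∀ ℚ-ring
    -- Square d N = m r p, replace N² by D r a p and cancel r p.
    reduced : + d ℤ.* + d ℤ.* + D ℤ.* + a ℤ.- m ℤ.* m ℤ.* + r ℤ.* + p ≡ 0ℤ
    reduced = ℤ.*-cancelˡ-≡ (+ r ℤ.* + p) _ 0ℤ {{ℤ.>-nonZero (pos-*⁺ (0<+ r) (0<+ p))}}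
      (trans (≡-modℤ (+ d ℤ.* Nℤ ℤ.+ m ℤ.* (+ r ℤ.* + p)) dN≡mrp
        (≡-modℤ (ℤ.- (+ d ℤ.* + d)) squareℤ (rp-identity (+ D) (+ r) (+ a) (+ p) (+ d) m)))
        (sym (ℤ.*-zeroʳ (+ r ℤ.* + p))))
      where
      rp-identity : ∀ D r a p d m → let N = 1ℤ ℤ.+ a ℤ.+ p in
        r ℤ.* p ℤ.* (d ℤ.* d ℤ.* D ℤ.* a ℤ.- m ℤ.* m ℤ.* r ℤ.* p)
        ≡ 0ℤ ℤ.+ (d ℤ.* N ℤ.+ m ℤ.* (r ℤ.* p)) ℤ.* (d ℤ.* N ℤ.- m ℤ.* (r ℤ.* p))
          ℤ.+ ℤ.- (d ℤ.* d) ℤ.* (N ℤ.* N ℤ.- D ℤ.* r ℤ.* a ℤ.* p)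
      rp-identity = ℤ-Solver.solve-∀
    identity : ∀ D r a p d m → let N = 1ℤ ℤ.+ a ℤ.+ p in
      d ℤ.* d ℤ.* D
      ≡ ((D ℤ.* r ℤ.* a ℤ.- + 2 ℤ.* N ℤ.+ p) ℤ.* (d ℤ.* d ℤ.* D)
          ℤ.- m ℤ.* m ℤ.* r ℤ.* (a ℤ.+ + 2)) ℤ.* p
        ℤ.+ d ℤ.* d ℤ.* D ℤ.* (N ℤ.* N ℤ.- D ℤ.* r ℤ.* a ℤ.* p)
        ℤ.+ ℤ.- (a ℤ.+ + 2) ℤ.* (d ℤ.* d ℤ.* D ℤ.* a ℤ.- m ℤ.* m ℤ.* r ℤ.* p)
    identity = ℤ-Solver.solve-∀

  denominator : Σ ℕ (IsDenominator T)
  denominator = let d , (1≤d , integral) , minimal = least hasDenominator? _ rap-hasDenominator in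
    d , 1≤d , integral , λ d′ 1≤d′ integral′ → minimal d′ (1≤d′ , integral′)

  -- As p divides the nonzero number d² D, it is at most d² D; d ≤ K would then give p ≤ K² D.
  denominator-large : ∀ K {d} → K ℕ.* K ℕ.* D ℕ.< p → IsDenominator T d → K ℕ.< d
  denominator-large K {d} K²D<p (1≤d , integral , _) = ℕ.≰⇒> λ d≤K →
    ℕ.<⇒≱ K²D<p (ℕ.≤-trans p≤d²D (ℕ.*-monoˡ-≤ D (ℕ.*-mono-≤ d≤K d≤K)))
    where
    p≤d²D : p ℕ.≤ d ℕ.* d ℕ.* D
    p≤d²D = ℕ.∣⇒≤ {{ℕ.m*n≢0 (d ℕ.* d) D {{ℕ.m*n≢0 d d {{ℕ.>-nonZero 1≤d}} {{ℕ.>-nonZero 1≤d}}}}}}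
      (p∣d²D d (1≤d , integral))

  realisable : ∀ k → ℤ.∣ k ∣ ℕ.* ℤ.∣ k ∣ ℕ.* D ℕ.< p → Realisable D k
  realisable k k²D<p =
    let d , isDenominator = denominator in
    T , d , nonDegenerate , pseudointegral , isDenominator ,
    below k (denominator-large ℤ.∣ k ∣ k²D<p isDenominator) ,
    card-interior , D ℕ.* 1 , card-boundary , cong +_ (ℕ.*-identityʳ D)
    where
    below : ∀ k {d} → ℤ.∣ k ∣ ℕ.< d → k ℤ.< + d
    below (+ n)    n<d = +<+ n<d
    below -[1+ n ] _   = -<+

-- Infinitely many solutions by Vieta jumping.

Solution : ℕ → ℕ → ℕ → Set
Solution E a p = (1 ℕ.+ a ℕ.+ p) ℕ.* (1 ℕ.+ a ℕ.+ p) ≡ E ℕ.* a ℕ.* p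

-- Vieta jumping: (a , p) becomes (p , (E - 2) p - 2 - a), in the coordinates a = 1 + α and
-- p = 1 + a + δ and with E = 5 + e.
solution-step : ∀ e α δ → Solution (5 ℕ.+ e) (1 ℕ.+ α) (2 ℕ.+ α ℕ.+ δ) →
  Solution (5 ℕ.+ e) (2 ℕ.+ α ℕ.+ δ) (3 ℕ.+ α ℕ.+ δ ℕ.+ (e ℕ.* (2 ℕ.+ α ℕ.+ δ) ℕ.+ α ℕ.+ 2 ℕ.* δ))
-- Adding `E * a * p` to both sides lets the old and the new equation be compared without
-- subtraction in ℕ.
solution-step e α δ sol = ℕ.+-cancelʳ-≡ (E ℕ.* a ℕ.* p) _ (E ℕ.* p ℕ.* p′)
  (trans (identity e α δ) (cong (ℕ._+_ (E ℕ.* p ℕ.* p′)) sol))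
  where
  E = 5 ℕ.+ e
  a = 1 ℕ.+ α
  p = 2 ℕ.+ α ℕ.+ δ
  p′ = 3 ℕ.+ α ℕ.+ δ ℕ.+ (e ℕ.* p ℕ.+ α ℕ.+ 2 ℕ.* δ)
  identity : ∀ e α δ →
    let a = 1 ℕ.+ α ; p = 2 ℕ.+ α ℕ.+ δ
        p′ = 3 ℕ.+ α ℕ.+ δ ℕ.+ (e ℕ.* p ℕ.+ α ℕ.+ 2 ℕ.* δ)
    in (1 ℕ.+ p ℕ.+ p′) ℕ.* (1 ℕ.+ p ℕ.+ p′) ℕ.+ (5 ℕ.+ e) ℕ.* a ℕ.* p
       ≡ (5 ℕ.+ e) ℕ.* p ℕ.* p′ ℕ.+ (1 ℕ.+ a ℕ.+ p) ℕ.* (1 ℕ.+ a ℕ.+ p)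
  identity = ℕ-Solver.solve-∀

-- A jump replaces α by 1 + α + δ, so n jumps raise it to at least n. The bounds a < p and E ≥ 5 are
-- built into the natural parameters and hence persist.
solution-large : ∀ e α δ → Solution (5 ℕ.+ e) (1 ℕ.+ α) (2 ℕ.+ α ℕ.+ δ) → ∀ n →
  ∃ λ α → ∃ λ δ → Solution (5 ℕ.+ e) (1 ℕ.+ α) (2 ℕ.+ α ℕ.+ δ) × (n ℕ.≤ α)
solution-large e α δ sol zero    = α , δ , sol , z≤n
solution-large e α δ sol (suc n) =
  let α , δ , sol , n≤α = solution-large e α δ sol n in
  1 ℕ.+ α ℕ.+ δ , e ℕ.* (2 ℕ.+ α ℕ.+ δ) ℕ.+ α ℕ.+ 2 ℕ.* δ ,
  solution-step e α δ sol , s≤s (ℕ.≤-trans n≤α (ℕ.m≤m+n α δ))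


-- The seeds used below are (a , p) = (1 , 4), (1 , 2), (2 , 3), (4 , 5) for D r = 9, 8, 6, 5.
realisable-from-seed : ∀ D r e α δ .{{_ : ℕ.NonZero D}} .{{_ : ℕ.NonZero r}} →
  5 ℕ.+ e ≡ D ℕ.* r → Solution (5 ℕ.+ e) (1 ℕ.+ α) (2 ℕ.+ α ℕ.+ δ) → ∀ k → Realisable D k
realisable-from-seed D r e α δ E≡Dr seed k =
  let α , δ , sol , k²D≤α = solution-large e α δ seed (ℤ.∣ k ∣ ℕ.* ℤ.∣ k ∣ ℕ.* D)
      a = 1 ℕ.+ α
      p = 2 ℕ.+ α ℕ.+ δ
      w , rapw≡N = apex r a p
  in Family.realisable D r a p (trans sol (cong (λ E → E ℕ.* a ℕ.* p) E≡Dr)) w rapw≡N k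
       -- Since p = 2 + α + δ, the bound on α makes p exceed k² D.
       (s≤s (ℕ.≤-trans k²D≤α (ℕ.≤-trans (ℕ.m≤m+n α δ) (ℕ.n≤1+n _))))

theorem1p3 : (b : ℤ) → ℤ.+ 1 ℤ.≤ b → b ℤ.≤ ℤ.+ 9 → b ≢ ℤ.+ 7 →
    (k : ℤ) → Σ Triangle λ T → Σ ℕ λ d →
    NonDegenerate T × Pseudointegral T × IsDenominator T d × (k ℤ.< ℤ.+ d) ×
    HasCard (λ p → InInterior T (ιP p)) 1 ×
    Σ ℕ λ nb → HasCard (λ p → OnBoundary T (ιP p)) nb × (ℤ.+ nb ≡ b)
theorem1p3 (+ 0) (+≤+ ()) _ _
-- Each admissible b divides 5, 6, 8 or 9, so D = b and r is the cofactor. The remaining numbers are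
-- e = D r - 5, α = a - 1 and δ = p - a - 1 for the seed, and `refl` checks both equations.
theorem1p3 (+ 1) _ _ _ = realisable-from-seed 1 9 4 0 2 refl refl
theorem1p3 (+ 2) _ _ _ = realisable-from-seed 2 4 3 0 0 refl refl
theorem1p3 (+ 3) _ _ _ = realisable-from-seed 3 3 4 0 2 refl refl
theorem1p3 (+ 4) _ _ _ = realisable-from-seed 4 2 3 0 0 refl refl
theorem1p3 (+ 5) _ _ _ = realisable-from-seed 5 1 0 3 0 refl refl
theorem1p3 (+ 6) _ _ _ = realisable-from-seed 6 1 1 1 0 refl refl
theorem1p3 (+ 7) _ _ b≢7 = ⊥-elim (b≢7 refl)
theorem1p3 (+ 8) _ _ _ = realisable-from-seed 8 1 3 0 0 refl refl
theorem1p3 (+ 9) _ _ _ = realisable-from-seed 9 1 4 0 2 refl refl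
theorem1p3 (+ suc (suc (suc (suc (suc (suc (suc (suc (suc (suc n))))))))))
  _ (+≤+ (s≤s (s≤s (s≤s (s≤s (s≤s (s≤s (s≤s (s≤s (s≤s ())))))))))) _
theorem1p3 -[1+ n ] () _ _
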